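{- Let $\mathcal A$ be cocomplete, $(M,\eta)$ a pointed endofunctor, and $\lambda:MH\to HM$ a distributive law of $(M,\eta)$ over $H$ with $\lambda$-interpretation $b:MC\to C$. Then for every morphism $e:X\to HMX$ there is a unique $e^\dagger:X\to C$ with $c\cdot e^\dagger=Hb\cdot HMe^\dagger\cdot e$.
   Context: $H:\mathcal A\to\mathcal A$ is a functor with terminal coalgebra $c:C\to HC$. A pointed endofunctor is a functor $M$ with a natural transformation $\eta:\mathrm{Id}\to M$. A distributive law of $(M,\eta)$ over $H$ is a natural transformation $\lambda:MH\to HM$ with $\lambda\cdot\eta H=H\eta$. Its $\lambda$-interpretation is the unique morphism $b:MC\to C$ with $c\cdot b=Hb\cdot\lambda_C\cdot Mc$ (i.e. the unique coalgebra homomorphism from $(MC,\lambda_C\cdot Mc)$ to $(C,c)$); it satisfies $b\cdot\eta_C=\mathrm{id}_C$. -}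

module Defs where

open import Level using (Level; _⊔_) renaming (suc to lsuc)
open import Relation.Binary.Core using (Rel)
open import Relation.Binary.Structures using (IsEquivalence)

private
  variable
    o ℓ e o′ ℓ′ e′ o″ ℓ″ e″ : Level

-- Hom-sets are setoids: equality of morphisms is _≈_, and there is no
-- equality of objects.
record Category (o ℓ e : Level) : Set (lsuc (o ⊔ ℓ ⊔ e)) where
  infix  4 _≈_ _⇒_
  infixr 9 _∘_
  field
    Obj : Set o
    _⇒_ : Rel Obj ℓ
    _≈_ : ∀ {A B} → Rel (A ⇒ B) e
    id  : ∀ {A} → A ⇒ A
    _∘_ : ∀ {A B C} → B ⇒ C → A ⇒ B → A ⇒ C

    assoc     : ∀ {A B C D} {f : A ⇒ B} {g : B ⇒ C} {h : C ⇒ D} →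
                (h ∘ g) ∘ f ≈ h ∘ (g ∘ f)
    identityˡ : ∀ {A B} {f : A ⇒ B} → id ∘ f ≈ f
    identityʳ : ∀ {A B} {f : A ⇒ B} → f ∘ id ≈ f
    equiv     : ∀ {A B} → IsEquivalence (_≈_ {A} {B})
    ∘-resp-≈  : ∀ {A B C} {f h : B ⇒ C} {g i : A ⇒ B} →
                f ≈ h → g ≈ i → f ∘ g ≈ h ∘ i

  module Equiv {A B : Obj} = IsEquivalence (equiv {A} {B})

record Functor (𝒞 : Category o ℓ e) (𝒟 : Category o′ ℓ′ e′)
       : Set (o ⊔ ℓ ⊔ e ⊔ o′ ⊔ ℓ′ ⊔ e′) where
  private
    module C = Category 𝒞
    module D = Category 𝒟
  field
    F₀ : C.Obj → D.Obj
    F₁ : ∀ {A B} → A C.⇒ B → F₀ A D.⇒ F₀ B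

    identity     : ∀ {A} → F₁ (C.id {A}) D.≈ D.id
    homomorphism : ∀ {X Y Z} {f : X C.⇒ Y} {g : Y C.⇒ Z} →
                   F₁ (g C.∘ f) D.≈ F₁ g D.∘ F₁ f
    F-resp-≈     : ∀ {A B} {f g : A C.⇒ B} → f C.≈ g → F₁ f D.≈ F₁ g

Endofunctor : Category o ℓ e → Set (o ⊔ ℓ ⊔ e)
Endofunctor 𝒞 = Functor 𝒞 𝒞

idF : {𝒞 : Category o ℓ e} → Endofunctor 𝒞
idF {𝒞 = 𝒞} = record
  { F₀           = λ A → A
  ; F₁           = λ f → f
  ; identity     = Equiv.refl
  ; homomorphism = Equiv.refl
  ; F-resp-≈     = λ p → p
  }
  where open Category 𝒞

infixr 9 _∘F_

_∘F_ : {𝒞 : Category o ℓ e} {𝒟 : Category o′ ℓ′ e′} {ℰ : Category o″ ℓ″ e″} →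
       Functor 𝒟 ℰ → Functor 𝒞 𝒟 → Functor 𝒞 ℰ
_∘F_ {ℰ = ℰ} G F = record
  { F₀           = λ A → G.F₀ (F.F₀ A)
  ; F₁           = λ f → G.F₁ (F.F₁ f)
  ; identity     = Equiv.trans (G.F-resp-≈ F.identity) G.identity
  ; homomorphism = Equiv.trans (G.F-resp-≈ F.homomorphism) G.homomorphism
  ; F-resp-≈     = λ p → G.F-resp-≈ (F.F-resp-≈ p)
  }
  where
    open Category ℰ
    module F = Functor F
    module G = Functor G

record NaturalTransformation {𝒞 : Category o ℓ e} {𝒟 : Category o′ ℓ′ e′}
       (F G : Functor 𝒞 𝒟) : Set (o ⊔ ℓ ⊔ e ⊔ o′ ⊔ ℓ′ ⊔ e′) where
  private
    module C = Category 𝒞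
    module F = Functor F
    module G = Functor G
  open Category 𝒟
  field
    η       : ∀ X → F.F₀ X ⇒ G.F₀ X
    commute : ∀ {X Y} (f : X C.⇒ Y) → η Y ∘ F.F₁ f ≈ G.F₁ f ∘ η X

module _ {𝒥 : Category o′ ℓ′ e′} {𝒞 : Category o ℓ e} (D : Functor 𝒥 𝒞) where
  private
    module J = Category 𝒥
    module D = Functor D
  open Category 𝒞

  record Cocone : Set (o′ ⊔ ℓ′ ⊔ o ⊔ ℓ ⊔ e) where
    field
      apex    : Obj
      ψ       : ∀ j → D.F₀ j ⇒ apex
      commute : ∀ {i j} (f : i J.⇒ j) → ψ j ∘ D.F₁ f ≈ ψ i

  record Colimit : Set (o′ ⊔ ℓ′ ⊔ o ⊔ ℓ ⊔ e) where
    field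
      cocone : Cocone
    open Cocone cocone public
    field
      rep        : (K : Cocone) → apex ⇒ Cocone.apex K
      rep-∘ψ     : (K : Cocone) → ∀ j → rep K ∘ ψ j ≈ Cocone.ψ K j
      rep-unique : (K : Cocone) (f : apex ⇒ Cocone.apex K) →
                   (∀ j → f ∘ ψ j ≈ Cocone.ψ K j) → rep K ≈ f

-- The universe Set s determines which diagrams count as small.
Cocomplete : (s : Level) → Category o ℓ e → Set (o ⊔ ℓ ⊔ e ⊔ lsuc s)
Cocomplete s 𝒞 = (𝒥 : Category s s s) (D : Functor 𝒥 𝒞) → Colimit D

module _ {𝒜 : Category o ℓ e} where
  open Category 𝒜

  record Coalgebra (H : Endofunctor 𝒜) : Set (o ⊔ ℓ) where
    constructor coalgebra
    open Functor H
    field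
      carrier   : Obj
      structure : carrier ⇒ F₀ carrier

  IsCoalgebraHom : {H : Endofunctor 𝒜} (X Y : Coalgebra H) →
                   Coalgebra.carrier X ⇒ Coalgebra.carrier Y → Set e
  IsCoalgebraHom {H} X Y f = Y.structure ∘ f ≈ F₁ f ∘ X.structure
    where
      open Functor H
      module X = Coalgebra X
      module Y = Coalgebra Y

  record TerminalCoalgebra (H : Endofunctor 𝒜) : Set (o ⊔ ℓ ⊔ e) where
    field
      terminal : Coalgebra H
    open Coalgebra terminal public renaming (carrier to C; structure to c)
    field
      !        : (X : Coalgebra H) → Coalgebra.carrier X ⇒ C
      !-isHom  : (X : Coalgebra H) → IsCoalgebraHom X terminal (! X)
      !-unique : (X : Coalgebra H) (f : Coalgebra.carrier X ⇒ C) →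
                 IsCoalgebraHom X terminal f → ! X ≈ f

record PointedEndofunctor (𝒜 : Category o ℓ e) : Set (o ⊔ ℓ ⊔ e) where
  field
    functor : Endofunctor 𝒜
    unit    : NaturalTransformation idF functor
  open Functor functor public
  open NaturalTransformation unit public using (η) renaming (commute to η-commute)

module _ {𝒜 : Category o ℓ e} (M : PointedEndofunctor 𝒜) (H : Endofunctor 𝒜) where
  private
    module M = PointedEndofunctor M
    module H = Functor H
  open Category 𝒜

  record DistributiveLaw : Set (o ⊔ ℓ ⊔ e) where
    field
      law : NaturalTransformation (M.functor ∘F H) (H ∘F M.functor)
    open NaturalTransformation law public renaming (η to component)
    field
      unit-law : ∀ X → component X ∘ M.η (H.F₀ X) ≈ H.F₁ (M.η X)

module _ {𝒜 : Category o ℓ e} {M : PointedEndofunctor 𝒜} {H : Endofunctor 𝒜} where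
  private
    module M = PointedEndofunctor M
  open Category 𝒜

  interpretation : (T : TerminalCoalgebra H) → DistributiveLaw M H →
                   M.F₀ (TerminalCoalgebra.C T) ⇒ TerminalCoalgebra.C T
  interpretation T λ′ = ! (coalgebra (M.F₀ C) (component C ∘ M.F₁ c))
    where
      open TerminalCoalgebra T
      open DistributiveLaw λ′ using (component)

{-# OPTIONS --safe #-}

-- From e one obtains morphisms εₙ : MⁿX → H Mⁿ⁺¹X by ε₀ = e and
-- εₙ₊₁ = λ · M εₙ.  A solution s extends to the family h₀ = s, hₙ₊₁ = b · M hₙ,
-- which is a cocone on the diagram of all the morphisms MⁱηMʲ between the MⁿX
-- and satisfies c · hₙ = H hₙ₊₁ · εₙ.  The ε's make the colimit of that diagram
-- a coalgebra, and such families are exactly its homomorphisms into C; so there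
-- is exactly one, h.  It remains to see that h has the form above.  Both hₙ₊₁
-- and b · M hₙ are families of the same kind on the image of the diagram under
-- M, with λ · M εₙ in place of εₙ, so they agree.  Closing the diagram under M
-- (rather than taking just the chain of the ηMⁿ) is what makes both of them
-- cocones on that image.
module Submission where

open import Level using (Level; Lift; lift; lower; 0ℓ) renaming (_⊔_ to _⊔ˡ_)
open import Data.Nat.Base using (ℕ; zero; suc)
open import Data.Product using (∃!; Σ; _×_; _,_; proj₁; proj₂)
open import Relation.Binary.Bundles using (Setoid)
open import Relation.Binary.Construct.Closure.ReflexiveTransitive using (Star; ε; _◅_; _◅◅_)
open import Relation.Binary.Construct.Closure.ReflexiveTransitive.Properties using (◅◅-assoc)
open import Relation.Binary.Core using (Rel)
open import Relation.Binary.PropositionalEquality.Core using (_≡_; refl; cong; cong₂; sym)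
open import Relation.Binary.PropositionalEquality.Properties using (isEquivalence)
import Relation.Binary.Reasoning.Setoid as SetoidReasoning
open import Defs

private
  variable
    o ℓ e : Level

-- Equational reasoning in the hom-setoids.

module HomReasoning (𝒜 : Category o ℓ e) where
  open Category 𝒜

  homSetoid : Obj → Obj → Setoid ℓ e
  homSetoid A B = record { isEquivalence = equiv {A} {B} }

  module _ {A B : Obj} where
    open SetoidReasoning (homSetoid A B) public

  ∘-congˡ : ∀ {A B C} {f : B ⇒ C} {g h : A ⇒ B} → g ≈ h → f ∘ g ≈ f ∘ h
  ∘-congˡ = ∘-resp-≈ Equiv.refl

  ∘-congʳ : ∀ {A B C} {f g : B ⇒ C} {h : A ⇒ B} → f ≈ g → f ∘ h ≈ g ∘ h
  ∘-congʳ p = ∘-resp-≈ p Equiv.refl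

  pullʳ : ∀ {A B C D} {f : C ⇒ D} {g : B ⇒ C} {h : A ⇒ B} {k : A ⇒ C} →
          g ∘ h ≈ k → (f ∘ g) ∘ h ≈ f ∘ k
  pullʳ p = Equiv.trans assoc (∘-congˡ p)

  pullˡ : ∀ {A B C D} {f : C ⇒ D} {g : B ⇒ C} {h : A ⇒ B} {k : B ⇒ D} →
          f ∘ g ≈ k → f ∘ (g ∘ h) ≈ k ∘ h
  pullˡ p = Equiv.trans (Equiv.sym assoc) (∘-congʳ p)

  extendʳ : ∀ {A B B′ C D} {f : C ⇒ D} {g : B ⇒ C} {h : A ⇒ B}
              {g′ : B′ ⇒ C} {h′ : A ⇒ B′} →
            g ∘ h ≈ g′ ∘ h′ → (f ∘ g) ∘ h ≈ (f ∘ g′) ∘ h′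
  extendʳ p = Equiv.trans (pullʳ p) (Equiv.sym assoc)

  extendˡ : ∀ {A B C C′ D} {f : C ⇒ D} {g : B ⇒ C} {h : A ⇒ B}
              {f′ : C′ ⇒ D} {g′ : B ⇒ C′} →
            f ∘ g ≈ f′ ∘ g′ → f ∘ (g ∘ h) ≈ f′ ∘ (g′ ∘ h)
  extendˡ p = Equiv.trans (pullˡ p) assoc

-- Diagrams over graphs and the free categories that index them.

record Graph : Set₁ where
  field
    Vertex : Set
    Edge   : Rel Vertex 0ℓ

-- A graph has no relations between paths to respect, so functors and cocones are determined on
-- edges. `Lift` brings it to the level at which `Cocomplete s` provides colimits.
freeCategory : (s : Level) → Graph → Category s s s
freeCategory s G = record
  { Obj       = Lift s Vertex
  ; _⇒_       = λ i j → Lift s (Star Edge (lower i) (lower j))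
  ; _≈_       = _≡_
  ; id        = lift ε
  ; _∘_       = λ q p → lift (lower p ◅◅ lower q)
  ; assoc     = λ {_} {_} {_} {_} {p} {q} {r} →
                cong lift (sym (◅◅-assoc (lower p) (lower q) (lower r)))
  ; identityˡ = λ {_} {_} {p} → cong lift (◅◅-identityʳ (lower p))
  ; identityʳ = refl
  ; equiv     = isEquivalence
  ; ∘-resp-≈  = cong₂ (λ q p → lift (lower p ◅◅ lower q))
  }
  where
    open Graph G
    ◅◅-identityʳ : ∀ {i j} (p : Star Edge i j) → p ◅◅ ε ≡ p
    ◅◅-identityʳ ε       = refl
    ◅◅-identityʳ (f ◅ p) = cong (f ◅_) (◅◅-identityʳ p)

record Diagram (G : Graph) (𝒜 : Category o ℓ e) : Set (o ⊔ˡ ℓ) where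
  open Graph G
  open Category 𝒜
  field
    D₀ : Vertex → Obj
    D₁ : ∀ {i j} → Edge i j → D₀ i ⇒ D₀ j

  IsCocone : {A : Obj} → (∀ i → D₀ i ⇒ A) → Set e
  IsCocone ψ = ∀ {i j} (f : Edge i j) → ψ j ∘ D₁ f ≈ ψ i

mapDiagram : {G : Graph} {𝒜 : Category o ℓ e} → Endofunctor 𝒜 → Diagram G 𝒜 → Diagram G 𝒜
mapDiagram F D = record
  { D₀ = λ i → F₀ (D₀ i)
  ; D₁ = λ f → F₁ (D₁ f)
  }
  where
    open Functor F
    open Diagram D

module _ (s : Level) {G : Graph} {𝒜 : Category o ℓ e} (D : Diagram G 𝒜) where
  open Graph G
  open Category 𝒜
  open HomReasoning 𝒜
  open Diagram D

  D⋆ : ∀ {i j} → Star Edge i j → D₀ i ⇒ D₀ j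
  D⋆ ε       = id
  D⋆ (f ◅ p) = D⋆ p ∘ D₁ f

  D⋆-◅◅ : ∀ {i j k} (p : Star Edge i j) (q : Star Edge j k) → D⋆ (p ◅◅ q) ≈ D⋆ q ∘ D⋆ p
  D⋆-◅◅ ε       q = Equiv.sym identityʳ
  D⋆-◅◅ (f ◅ p) q = Equiv.trans (∘-congʳ (D⋆-◅◅ p q)) assoc

  diagramFunctor : Functor (freeCategory s G) 𝒜
  diagramFunctor = record
    { F₀           = λ i → D₀ (lower i)
    ; F₁           = λ p → D⋆ (lower p)
    ; identity     = Equiv.refl
    ; homomorphism = λ {_} {_} {_} {p} {q} → D⋆-◅◅ (lower p) (lower q)
    ; F-resp-≈     = λ { refl → Equiv.refl }
    }

  cocone-D⋆ : ∀ {A} {ψ : ∀ i → D₀ i ⇒ A} → IsCocone ψ →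
              ∀ {i j} (p : Star Edge i j) → ψ j ∘ D⋆ p ≈ ψ i
  cocone-D⋆ ψ-cocone ε       = identityʳ
  cocone-D⋆ ψ-cocone (f ◅ p) = Equiv.trans (pullˡ (cocone-D⋆ ψ-cocone p)) (ψ-cocone f)

  toCocone : ∀ {A} (ψ : ∀ i → D₀ i ⇒ A) → IsCocone ψ → Cocone diagramFunctor
  toCocone {A} ψ ψ-cocone = record
    { apex    = A
    ; ψ       = λ i → ψ (lower i)
    ; commute = λ p → cocone-D⋆ ψ-cocone (lower p)
    }

-- Coalgebras on diagrams and their solutions in `C`.

-- A coalgebra for H "up to the shift σ" on a whole diagram.
record DiagramCoalgebra {G : Graph} {𝒜 : Category o ℓ e} (H : Endofunctor 𝒜) (D : Diagram G 𝒜)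
       : Set (ℓ ⊔ˡ e) where
  open Graph G
  open Category 𝒜
  open Diagram D
  private
    module H = Functor H
  field
    σ₀        : Vertex → Vertex
    σ₁        : ∀ {i j} → Edge i j → Edge (σ₀ i) (σ₀ j)
    ξ         : ∀ i → D₀ i ⇒ H.F₀ (D₀ (σ₀ i))
    ξ-commute : ∀ {i j} (f : Edge i j) → ξ j ∘ D₁ f ≈ H.F₁ (D₁ (σ₁ f)) ∘ ξ i

module _ (s : Level) {G : Graph} {𝒜 : Category o ℓ e} (cocomplete : Cocomplete s 𝒜)
         {H : Endofunctor 𝒜} (T : TerminalCoalgebra H)
         {D : Diagram G 𝒜} (Ξ : DiagramCoalgebra H D) where
  open Category 𝒜
  open HomReasoning 𝒜
  open Diagram D
  open DiagramCoalgebra Ξ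
  open TerminalCoalgebra T
  private
    module H = Functor H

  IsSolution : (∀ i → D₀ i ⇒ C) → Set e
  IsSolution h = ∀ i → c ∘ h i ≈ H.F₁ (h (σ₀ i)) ∘ ξ i

  private
    module L = Colimit (cocomplete (freeCategory s G) (diagramFunctor s D))

    ι : ∀ i → D₀ i ⇒ L.apex
    ι i = L.ψ (lift i)

    ι-cocone : IsCocone ι
    -- The one-edge path is interpreted as `id ∘ D₁ f`, not as `D₁ f`.
    ι-cocone f = Equiv.trans (∘-congˡ (Equiv.sym identityˡ)) (L.commute (lift (f ◅ ε)))

    jointly-epic : ∀ {A} {f g : L.apex ⇒ A} → (∀ i → f ∘ ι i ≈ g ∘ ι i) → f ≈ g
    jointly-epic {f = f} {g} p = Equiv.trans
      (Equiv.sym (L.rep-unique K f (λ i → p (lower i))))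
      (L.rep-unique K g (λ _ → Equiv.refl))
      where
        K = toCocone s D (λ i → g ∘ ι i) (λ f → pullʳ (ι-cocone f))

    -- All legs share one apex, so the shift `σ₀` disappears in the colimit and the maps `ξ i`
    -- induce an ordinary coalgebra structure.
    structureCocone : Cocone (diagramFunctor s D)
    structureCocone = toCocone s D (λ i → H.F₁ (ι (σ₀ i)) ∘ ξ i) λ {i} {j} f → begin
      (H.F₁ (ι (σ₀ j)) ∘ ξ j) ∘ D₁ f              ≈⟨ extendʳ (ξ-commute f) ⟩
      (H.F₁ (ι (σ₀ j)) ∘ H.F₁ (D₁ (σ₁ f))) ∘ ξ i  ≈⟨ ∘-congʳ H.homomorphism ⟨
      H.F₁ (ι (σ₀ j) ∘ D₁ (σ₁ f)) ∘ ξ i           ≈⟨ ∘-congʳ (H.F-resp-≈ (ι-cocone (σ₁ f))) ⟩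
      H.F₁ (ι (σ₀ i)) ∘ ξ i                       ∎

    γ : L.apex ⇒ H.F₀ L.apex
    γ = L.rep structureCocone

    Γ : Coalgebra H
    Γ = coalgebra L.apex γ

    -- Used in both directions: it turns a homomorphism out of `Γ` into a solution, and a solution
    -- into a homomorphism.
    H[_]∘γ : ∀ (h : L.apex ⇒ C) i → (H.F₁ h ∘ γ) ∘ ι i ≈ H.F₁ (h ∘ ι (σ₀ i)) ∘ ξ i
    H[ h ]∘γ i = begin
      (H.F₁ h ∘ γ) ∘ ι i                 ≈⟨ pullʳ (L.rep-∘ψ structureCocone (lift i)) ⟩
      H.F₁ h ∘ (H.F₁ (ι (σ₀ i)) ∘ ξ i)   ≈⟨ pullˡ (Equiv.sym H.homomorphism) ⟩
      H.F₁ (h ∘ ι (σ₀ i)) ∘ ξ i          ∎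

  solution-exists : Σ (∀ i → D₀ i ⇒ C) λ h → IsCocone h × IsSolution h
  solution-exists = (λ i → ! Γ ∘ ι i) , (λ f → pullʳ (ι-cocone f)) , λ i → begin
    c ∘ (! Γ ∘ ι i)                ≈⟨ pullˡ (!-isHom Γ) ⟩
    (H.F₁ (! Γ) ∘ γ) ∘ ι i         ≈⟨ H[ ! Γ ]∘γ i ⟩
    H.F₁ (! Γ ∘ ι (σ₀ i)) ∘ ξ i    ∎

  private
    -- The factorization of `h` through the colimit is a coalgebra homomorphism, as can be tested on
    -- the legs; terminality then identifies it with `! Γ`.
    solution-≈-! : (h : ∀ i → D₀ i ⇒ C) → IsCocone h → IsSolution h → ∀ i → ! Γ ∘ ι i ≈ h i
    solution-≈-! h h-cocone h-solution i =
      Equiv.trans (∘-congʳ (!-unique Γ [h] (jointly-epic [h]-isHom))) ([h]∘ι i)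
      where
        K = toCocone s D h h-cocone
        [h] = L.rep K

        [h]∘ι : ∀ j → [h] ∘ ι j ≈ h j
        [h]∘ι j = L.rep-∘ψ K (lift j)

        [h]-isHom : ∀ j → (c ∘ [h]) ∘ ι j ≈ (H.F₁ [h] ∘ γ) ∘ ι j
        [h]-isHom j = begin
          (c ∘ [h]) ∘ ι j                ≈⟨ pullʳ ([h]∘ι j) ⟩
          c ∘ h j                        ≈⟨ h-solution j ⟩
          H.F₁ (h (σ₀ j)) ∘ ξ j          ≈⟨ ∘-congʳ (H.F-resp-≈ ([h]∘ι (σ₀ j))) ⟨
          H.F₁ ([h] ∘ ι (σ₀ j)) ∘ ξ j    ≈⟨ H[ [h] ]∘γ j ⟨
          (H.F₁ [h] ∘ γ) ∘ ι j           ∎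

  solution-unique : {h k : ∀ i → D₀ i ⇒ C} → IsCocone h → IsSolution h →
                    IsCocone k → IsSolution k → ∀ i → h i ≈ k i
  solution-unique {h} {k} h-cocone h-solution k-cocone k-solution i = Equiv.trans
    (Equiv.sym (solution-≈-! h h-cocone h-solution i))
    (solution-≈-! k k-cocone k-solution i)

-- The diagram of iterates of `M`.

-- The edge  under (… (under (unit j)))  with i occurrences of under stands for
-- MⁱηMʲ.
data PointEdge : Rel ℕ 0ℓ where
  unit  : ∀ n → PointEdge n (suc n)
  under : ∀ {m n} → PointEdge m n → PointEdge (suc m) (suc n)

-- Sends MⁱηMʲ to MⁱηMʲ⁺¹, whereas `under` sends it to Mⁱ⁺¹ηMʲ. They already differ on `unit 0`: ηM
-- against Mη.
shift : ∀ {m n} → PointEdge m n → PointEdge (suc m) (suc n)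
shift (unit n)  = unit (suc n)
shift (under f) = under (shift f)

pointGraph : Graph
pointGraph = record { Vertex = ℕ ; Edge = PointEdge }

module _ {𝒜 : Category o ℓ e} (M : PointedEndofunctor 𝒜) where
  open Category 𝒜
  private
    module M = PointedEndofunctor M

  iterate : Obj → ℕ → Obj
  iterate X zero    = X
  iterate X (suc n) = M.F₀ (iterate X n)

  iterateEdge : ∀ X {m n} → PointEdge m n → iterate X m ⇒ iterate X n
  iterateEdge X (unit n)  = M.η (iterate X n)
  iterateEdge X (under f) = M.F₁ (iterateEdge X f)

  iterates : Obj → Diagram pointGraph 𝒜
  iterates X = record { D₀ = iterate X ; D₁ = iterateEdge X }

-- The distributive law, its interpretation, and the family generated by `e`.

module _ {𝒜 : Category o ℓ e} {H : Endofunctor 𝒜} (T : TerminalCoalgebra H)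
         {M : PointedEndofunctor 𝒜} (λ′ : DistributiveLaw M H) where
  open Category 𝒜
  open HomReasoning 𝒜
  open TerminalCoalgebra T
  open DistributiveLaw λ′
  private
    module H = Functor H
    module M = PointedEndofunctor M
    b = interpretation T λ′

  interpretation-isHom : c ∘ b ≈ H.F₁ b ∘ (component C ∘ M.F₁ c)
  interpretation-isHom = !-isHom _

  -- By the unit law, `b ∘ M.η C` is an endomorphism of the terminal coalgebra.
  interpretation-unit : b ∘ M.η C ≈ id
  interpretation-unit = Equiv.trans
    (Equiv.sym (!-unique terminal (b ∘ M.η C) b∘η-isHom))
    (!-unique terminal id (Equiv.trans identityʳ
      (Equiv.sym (Equiv.trans (∘-congʳ H.identity) identityˡ))))
    where
      b∘η-isHom : c ∘ (b ∘ M.η C) ≈ H.F₁ (b ∘ M.η C) ∘ c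
      b∘η-isHom = begin
        c ∘ (b ∘ M.η C)                                  ≈⟨ extendˡ interpretation-isHom ⟩
        H.F₁ b ∘ ((component C ∘ M.F₁ c) ∘ M.η C)        ≈⟨ ∘-congˡ (extendʳ (Equiv.sym (M.η-commute c))) ⟩
        H.F₁ b ∘ ((component C ∘ M.η (H.F₀ C)) ∘ c)      ≈⟨ ∘-congˡ (∘-congʳ (unit-law C)) ⟩
        H.F₁ b ∘ (H.F₁ (M.η C) ∘ c)                      ≈⟨ pullˡ (Equiv.sym H.homomorphism) ⟩
        H.F₁ (b ∘ M.η C) ∘ c                             ∎

  interpretation-absorbs-unit : ∀ {A} (h : A ⇒ C) → (b ∘ M.F₁ h) ∘ M.η A ≈ h
  interpretation-absorbs-unit {A} h = begin
    (b ∘ M.F₁ h) ∘ M.η A   ≈⟨ extendʳ (Equiv.sym (M.η-commute h)) ⟩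
    (b ∘ M.η C) ∘ h        ≈⟨ ∘-congʳ interpretation-unit ⟩
    id ∘ h                 ≈⟨ identityˡ ⟩
    h                      ∎

  -- For `A = B` this is the lifting of `M` to coalgebras for `H`; a separate `B` leaves room for
  -- the shift.
  distribute : ∀ {A B} → A ⇒ H.F₀ B → M.F₀ A ⇒ H.F₀ (M.F₀ B)
  distribute {B = B} ξ = component B ∘ M.F₁ ξ

  distribute-unit : ∀ {A B} (ξ : A ⇒ H.F₀ B) → distribute ξ ∘ M.η A ≈ H.F₁ (M.η B) ∘ ξ
  distribute-unit {A} {B} ξ = begin
    (component B ∘ M.F₁ ξ) ∘ M.η A          ≈⟨ extendʳ (Equiv.sym (M.η-commute ξ)) ⟩
    (component B ∘ M.η (H.F₀ B)) ∘ ξ        ≈⟨ ∘-congʳ (unit-law B) ⟩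
    H.F₁ (M.η B) ∘ ξ                        ∎

  -- Functoriality of `M` and naturality of the law. The square may be an edge of a diagram or, with
  -- `ξ′ = c`, a solution equation.
  distribute-commute : ∀ {A A′ B B′} {ξ : A ⇒ H.F₀ B} {ξ′ : A′ ⇒ H.F₀ B′}
                       {f : A ⇒ A′} {g : B ⇒ B′} → ξ′ ∘ f ≈ H.F₁ g ∘ ξ →
                       distribute ξ′ ∘ M.F₁ f ≈ H.F₁ (M.F₁ g) ∘ distribute ξ
  distribute-commute {B = B} {B′} {ξ} {ξ′} {f} {g} p = begin
    (component B′ ∘ M.F₁ ξ′) ∘ M.F₁ f           ≈⟨ pullʳ (Equiv.sym M.homomorphism) ⟩
    component B′ ∘ M.F₁ (ξ′ ∘ f)                ≈⟨ ∘-congˡ (M.F-resp-≈ p) ⟩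
    component B′ ∘ M.F₁ (H.F₁ g ∘ ξ)            ≈⟨ ∘-congˡ M.homomorphism ⟩
    component B′ ∘ (M.F₁ (H.F₁ g) ∘ M.F₁ ξ)     ≈⟨ extendˡ (commute g) ⟩
    H.F₁ (M.F₁ g) ∘ (component B ∘ M.F₁ ξ)      ∎

  interpretation-distribute : ∀ {A B} {ξ : A ⇒ H.F₀ B} {h : A ⇒ C} {k : B ⇒ C} →
                              c ∘ h ≈ H.F₁ k ∘ ξ →
                              c ∘ (b ∘ M.F₁ h) ≈ H.F₁ (b ∘ M.F₁ k) ∘ distribute ξ
  interpretation-distribute {ξ = ξ} {h} {k} p = begin
    c ∘ (b ∘ M.F₁ h)                           ≈⟨ extendˡ interpretation-isHom ⟩
    H.F₁ b ∘ (distribute c ∘ M.F₁ h)           ≈⟨ ∘-congˡ (distribute-commute p) ⟩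
    H.F₁ b ∘ (H.F₁ (M.F₁ k) ∘ distribute ξ)    ≈⟨ pullˡ (Equiv.sym H.homomorphism) ⟩
    H.F₁ (b ∘ M.F₁ k) ∘ distribute ξ           ∎

  interpretation-extend : ∀ {A A′} {h : A ⇒ C} {h′ : A′ ⇒ C} {f : A ⇒ A′} → h′ ∘ f ≈ h →
                          (b ∘ M.F₁ h′) ∘ M.F₁ f ≈ b ∘ M.F₁ h
  interpretation-extend p = pullʳ (Equiv.trans (Equiv.sym M.homomorphism) (M.F-resp-≈ p))

  distributeCoalgebra : {G : Graph} {D : Diagram G 𝒜} →
                        DiagramCoalgebra H D → DiagramCoalgebra H (mapDiagram M.functor D)
  distributeCoalgebra Ξ = record
    { σ₀        = σ₀
    ; σ₁        = σ₁
    ; ξ         = λ i → distribute (ξ i)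
    ; ξ-commute = λ f → distribute-commute (ξ-commute f)
    }
    where open DiagramCoalgebra Ξ

  module _ {X : Obj} (e : X ⇒ H.F₀ (M.F₀ X)) where
    unfold : ∀ n → iterate M X n ⇒ H.F₀ (iterate M X (suc n))
    unfold zero    = e
    unfold (suc n) = distribute (unfold n)

    -- The unit law settles ηMⁿ and produces ηMⁿ⁺¹ under `H`, which is why the edges move by
    -- `shift`.
    unfold-commute : ∀ {m n} (f : PointEdge m n) →
                     unfold n ∘ iterateEdge M X f ≈ H.F₁ (iterateEdge M X (shift f)) ∘ unfold m
    unfold-commute (unit n)  = distribute-unit (unfold n)
    unfold-commute (under f) = distribute-commute (unfold-commute f)

    unfoldCoalgebra : DiagramCoalgebra H (iterates M X)
    unfoldCoalgebra = record
      { σ₀ = suc ; σ₁ = shift ; ξ = unfold ; ξ-commute = unfold-commute }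

    module _ (s : X ⇒ C) where
      extend : ∀ n → iterate M X n ⇒ C
      extend zero    = s
      extend (suc n) = b ∘ M.F₁ (extend n)

      extend-cocone : Diagram.IsCocone (iterates M X) extend
      extend-cocone (unit n)  = interpretation-absorbs-unit (extend n)
      extend-cocone (under f) = interpretation-extend (extend-cocone f)

      extend-solution : c ∘ s ≈ H.F₁ (b ∘ M.F₁ s) ∘ e →
                        ∀ n → c ∘ extend n ≈ H.F₁ (extend (suc n)) ∘ unfold n
      extend-solution p zero    = p
      extend-solution p (suc n) = interpretation-distribute (extend-solution p n)

mainTheorem13 :
    ∀ {o ℓ ℓ≈ s : Level} (𝒜 : Category o ℓ ℓ≈) (H : Endofunctor 𝒜) (T : TerminalCoalgebra H) →
    Cocomplete s 𝒜 →
    (M : PointedEndofunctor 𝒜) (λ′ : DistributiveLaw M H) →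
    let open Category 𝒜
        open TerminalCoalgebra T
        module H = Functor H
        module M = PointedEndofunctor M
        b = interpretation T λ′
    in
    (X : Obj) (e : X ⇒ H.F₀ (M.F₀ X)) →
    ∃! _≈_ (λ (e† : X ⇒ C) → c ∘ e† ≈ H.F₁ b ∘ (H.F₁ (M.F₁ e†) ∘ e))
mainTheorem13 {s = s} 𝒜 H T cocomplete M λ′ X e = h zero , h₀-equation , h₀-unique
  where
    open Category 𝒜
    open HomReasoning 𝒜
    open TerminalCoalgebra T
    module H = Functor H
    module M = PointedEndofunctor M
    b = interpretation T λ′
    Ξ = unfoldCoalgebra T λ′ e

    solution = solution-exists s cocomplete T Ξ
    h = proj₁ solution
    h-cocone = proj₁ (proj₂ solution)
    h-solution = proj₂ (proj₂ solution)

    h-suc : ∀ n → h (suc n) ≈ b ∘ M.F₁ (h n)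
    h-suc = solution-unique s cocomplete T (distributeCoalgebra T λ′ Ξ)
      -- In the image under `M`, vertex `n` is Mⁿ⁺¹X, the edge of `f` is that of `under f`, and the
      -- structure map is `unfold (suc n)`, all by definition. Hence `h` restricted to successors is
      -- a cocone solution there.
      (λ f → h-cocone (under f))
      (λ n → h-solution (suc n))
      -- The second cocone solution, `b ∘ M.F₁ (h n)`, inherits both properties from `h`.
      (λ f → interpretation-extend T λ′ (h-cocone f))
      (λ n → interpretation-distribute T λ′ (h-solution n))

    h₀-equation : c ∘ h zero ≈ H.F₁ b ∘ (H.F₁ (M.F₁ (h zero)) ∘ e)
    h₀-equation = begin
      c ∘ h zero                              ≈⟨ h-solution zero ⟩
      H.F₁ (h (suc zero)) ∘ e                 ≈⟨ ∘-congʳ (H.F-resp-≈ (h-suc zero)) ⟩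
      H.F₁ (b ∘ M.F₁ (h zero)) ∘ e            ≈⟨ pullˡ (Equiv.sym H.homomorphism) ⟨
      H.F₁ b ∘ (H.F₁ (M.F₁ (h zero)) ∘ e)     ∎

    h₀-unique : ∀ {k : X ⇒ C} → c ∘ k ≈ H.F₁ b ∘ (H.F₁ (M.F₁ k) ∘ e) → h zero ≈ k
    -- `extend` has `k` itself at vertex `zero`, so uniqueness of the whole family is read off
    -- there.
    h₀-unique {k} p = solution-unique s cocomplete T Ξ h-cocone h-solution
      (extend-cocone T λ′ e k)
      (extend-solution T λ′ e k (Equiv.trans p (pullˡ (Equiv.sym H.homomorphism))))
      zero
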